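{- Differential game logic $\mathsf{dGL}$ and the differential $\mu$-calculus $\mathsf{dL}\mu$ are equi-expressive: for every $\mathsf{dGL}$-formula there is a $\mathsf{dL}\mu$-formula true in exactly the same states of $\mathfrak R$, and for every $\mathsf{dL}\mu$-formula there is a $\mathsf{dGL}$-formula true in exactly the same states of $\mathfrak R$.
   Context: Fix an infinite set $\mathcal X$ of object variables and an infinite set $\mathcal V$ of propositional variables; each $X\in\mathcal V$ has a fresh complement $\overline X\notin\mathcal V$, $\overline{\overline X}=X$, $\overline{\mathcal V}=\mathcal V\cup\{\overline X:X\in\mathcal V\}$. $\mathcal L$ is the first-order signature of ordered fields; a literal is an atomic $\mathcal L$-formula over $\mathcal X$ or its negation. $\mathrm{Act}$ consists of the transition symbols $x:=*$ (nondeterministic assignment), $x:=\theta$ (deterministic assignment; $\theta$ an $\mathcal L$-term) and $x'=\theta\,\&\,\psi$ (continuous evolution; $x$ an $N$-tuple of variables, $\theta$ an $N$-tuple of $\mathcal L$-terms, i.e. polynomials, $\psi$ a first-order $\mathcal L$-formula, any $N$). $\mathfrak R$ is the structure $\mathbb R$ with states $\mathcal S=\{\omega:\mathcal X\to\mathbb R\}$ and $\mathfrak R[\![x:=\theta]\!]=\{(\omega,\omega[x\mapsto\omega[\![\theta]\!]])\}$, $\mathfrak R[\![x:=*]\!]=\{(\omega,\omega[x\mapsto r]):r\in\mathbb R\}$, and $(\omega,\nu)\in\mathfrak R[\![x'=\theta\,\&\,\psi]\!]$ iff $\nu$ agrees with $\omega$ off $x$ and for some $t\ge0$ there is a continuous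 $\gamma:[0,t]\to\mathbb R^N$, differentiable on $(0,t)$ with $\gamma'(s)=F(\gamma(s))$ there, with $\gamma(0)=\omega(x)$, $\gamma(t)=\nu(x)$ and $\gamma(s)\in K$ for all $s\in[0,t]$, where $F(r)=\omega[x\mapsto r][\![\theta]\!]$ and $K=\{r:\omega[x\mapsto r]\models\psi\}$. $\mathsf{dL}\mu$-formulas: formulas without free propositional variables given by $\varphi::=p\mid X\mid\varphi\lor\varphi\mid\varphi\land\varphi\mid\langle a\rangle\varphi\mid[a]\varphi\mid\mu X.\psi\mid\nu X.\psi$ with $p$ a literal, $X\in\overline{\mathcal V}$, $a\in\mathrm{Act}$, $\psi$ not mentioning $\overline X$. Semantics (sets of states, for a valuation of propositional variables by subsets of $\mathcal S$, $\overline X$ being interpreted as the complement of $X$): literals and connectives as usual, $\langle a\rangle,[a]$ the existential/universal modalities of $\mathfrak R[\![a]\!]$, and $\mu X.\varphi$, $\nu X.\varphi$ the least/greatest fixpoints of the monotone map sending a value $D$ of $X$ to the denotation of $\varphi$. $\mathsf{dGL}$-formulas and games: $\varphi::=p\mid\neg\varphi\mid\varphi\lor\varphi\mid\langle\gamma\rangle\varphi$, $\gamma::=a\mid{?\varphi}\mid\gamma\cup\gamma\mid\gamma;\gamma\mid\gamma^*\mid\gamma^d$. Semantics: $[\![\langle\gamma\rangle\varphi]\!]=[\![\gamma]\!]([\![\varphi]\!])$, where $[\![a]\!](D)=\{\omega:\exists(\omega,\nu)\in\mathfrak R[\![a]\!],\nu\in D\}$, $[\![?\varphi]\!](D)=[\![\varphi]\!]\cap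 D$, $[\![\gamma_1\cup\gamma_2]\!](D)=[\![\gamma_1]\!](D)\cup[\![\gamma_2]\!](D)$, $[\![\gamma_1;\gamma_2]\!](D)=[\![\gamma_1]\!]([\![\gamma_2]\!](D))$, $[\![\gamma^*]\!](D)=\bigcap\{Z:D\cup[\![\gamma]\!](Z)\subseteq Z\}$, $[\![\gamma^d]\!](D)=\mathcal S\setminus[\![\gamma]\!](\mathcal S\setminus D)$. -}

module Defs where

open import Level using (0ℓ)
open import Algebra.Structures using (IsCommutativeRing)
import Algebra.Construct.NaturalChoice.Max as Max
open import Axiom.ExcludedMiddle using (ExcludedMiddle)
open import Data.Bool using (Bool; T; not; if_then_else_)
open import Data.Empty using (⊥)
open import Data.Fin using (Fin)
open import Data.List using (List)
open import Data.List.Membership.Propositional using () renaming (_∉_ to _∉ˡ_)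
open import Data.Nat using (ℕ)
open import Data.Product using (Σ; ∃; _×_; proj₁)
open import Data.Sum using (_⊎_)
open import Data.Vec using (Vec; []; _∷_; map; lookup)
open import Data.Vec.Membership.Propositional using (_∉_)
open import Function using (_∘_)
open import Relation.Binary using (Rel; IsTotalOrder; TotalOrder)
import Relation.Binary.Construct.NonStrictToStrict as Strict
open import Relation.Binary.PropositionalEquality using (_≡_; _≢_)
open import Relation.Nullary using (¬_; does)
open import Relation.Unary using (Pred; Satisfiable; ∁; _⊆_; _≐_)

Infinite : Set → Set
Infinite A = (xs : List A) → ∃ λ x → x ∉ˡ xs

-- The complete ordered fields: assuming excluded middle, the axioms determine
-- the structure ℝ up to a unique isomorphism.
record RealField : Set₁ where
  infix  4 _≤_
  infixl 6 _+_
  infixl 7 _*_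
  infix  8 -_
  field
    ℝ                 : Set
    _≤_               : Rel ℝ 0ℓ
    _+_ _*_           : ℝ → ℝ → ℝ
    -_                : ℝ → ℝ
    0# 1#             : ℝ
    isCommutativeRing : IsCommutativeRing _≡_ _+_ _*_ -_ 0# 1#
    isTotalOrder      : IsTotalOrder _≡_ _≤_
    0≢1               : 0# ≢ 1#
    inverse           : ∀ x → x ≢ 0# → ∃ λ y → x * y ≡ 1#
    +-monoˡ-≤         : ∀ z {x y} → x ≤ y → x + z ≤ y + z
    *-nonneg          : ∀ {x y} → 0# ≤ x → 0# ≤ y → 0# ≤ x * y

  UpperBound : Pred ℝ 0ℓ → Pred ℝ 0ℓ
  UpperBound A b = ∀ {x} → A x → x ≤ b

  field
    supremum : (A : Pred ℝ 0ℓ) → Satisfiable A → Satisfiable (UpperBound A) →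
               ∃ λ s → UpperBound A s × (∀ {b} → UpperBound A b → s ≤ b)

  open Strict _≡_ _≤_ public using (_<_)

  totalOrder : TotalOrder 0ℓ 0ℓ 0ℓ
  totalOrder = record { isTotalOrder = isTotalOrder }

  open Max totalOrder public using (_⊔_)

  infixl 6 _-_
  _-_ : ℝ → ℝ → ℝ
  x - y = x + (- y)

  ∣_∣ : ℝ → ℝ
  ∣ x ∣ = x ⊔ (- x)

-- 𝒳: object variables, 𝒱: propositional variables.
module Syntax (𝒳 𝒱 : Set) where

  infixl 6 _⊕_
  infixl 7 _⊗_
  data Term : Set where
    var     : 𝒳 → Term
    𝟎 𝟏     : Term
    _⊕_ _⊗_ : Term → Term → Term
    ⊖_      : Term → Term

  infix 5 _≐ₜ_ _<ₜ_
  data Atom : Set where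
    _≐ₜ_ _<ₜ_ : Term → Term → Atom

  data Literal : Set where
    pos neg : Atom → Literal

  data FOFormula : Set where
    atom            : Atom → FOFormula
    ¬ᶠ_             : FOFormula → FOFormula
    _∧ᶠ_ _∨ᶠ_       : FOFormula → FOFormula → FOFormula
    existsᶠ forallᶠ : 𝒳 → FOFormula → FOFormula

  infix 5 _:=* _:=_
  data Act : Set where
    _:=*   : 𝒳 → Act
    _:=_   : 𝒳 → Term → Act
    evolve : ∀ {N} (x : Vec 𝒳 N) (θ : Vec Term N) (ψ : FOFormula) → Act

  -- 𝒱 together with a fresh complement for each of its elements.
  data PVar : Set where
    pos neg : 𝒱 → PVar

  complement : PVar → PVar
  complement (pos X) = neg X
  complement (neg X) = pos X

  -- Formulas of the differential μ-calculus, possibly with free propositional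
  -- variables.  Occurrences count as mentions whether free or bound.
  mutual
    infixr 2 _∨_
    infixr 3 _∧_
    infixr 4 ⟨_⟩_ [_]_
    data μFormula : Set where
      lit         : Literal → μFormula
      var         : PVar → μFormula
      _∨_ _∧_     : μFormula → μFormula → μFormula
      ⟨_⟩_ [_]_   : Act → μFormula → μFormula
      μ ν         : (X : PVar) (ψ : μFormula) → ¬ Mentions (complement X) ψ → μFormula

    Mentions : PVar → μFormula → Set
    Mentions X (lit p)   = ⊥
    Mentions X (var Y)   = X ≡ Y
    Mentions X (φ ∨ ψ)   = Mentions X φ ⊎ Mentions X ψ
    Mentions X (φ ∧ ψ)   = Mentions X φ ⊎ Mentions X ψ
    Mentions X (⟨ a ⟩ φ) = Mentions X φ
    Mentions X ([ a ] φ) = Mentions X φ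
    Mentions X (μ Y ψ _) = X ≡ Y ⊎ Mentions X ψ
    Mentions X (ν Y ψ _) = X ≡ Y ⊎ Mentions X ψ

  Free : PVar → μFormula → Set
  Free X (lit p)   = ⊥
  Free X (var Y)   = X ≡ Y
  Free X (φ ∨ ψ)   = Free X φ ⊎ Free X ψ
  Free X (φ ∧ ψ)   = Free X φ ⊎ Free X ψ
  Free X (⟨ a ⟩ φ) = Free X φ
  Free X ([ a ] φ) = Free X φ
  Free X (μ Y ψ _) = X ≢ Y × Free X ψ
  Free X (ν Y ψ _) = X ≢ Y × Free X ψ

  dLμ : Set
  dLμ = Σ μFormula λ φ → ∀ X → ¬ Free X φ

  mutual
    infixr 5 _∪_
    infixr 6 _⨾_
    data dGL : Set where
      lit  : Literal → dGL
      ¬ᵍ_  : dGL → dGL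
      _∨_  : dGL → dGL → dGL
      ⟨_⟩_ : Game → dGL → dGL

    data Game : Set where
      act       : Act → Game
      test      : dGL → Game
      _∪_ _⨾_   : Game → Game → Game
      loop dual : Game → Game

module Semantics (em : ExcludedMiddle 0ℓ) (𝒳 𝒱 : Set) (ℛ : RealField) where

  open RealField ℛ
  open Syntax 𝒳 𝒱 public

  -- States are compared by ≡, that is pointwise given function extensionality.
  State : Set
  State = 𝒳 → ℝ

  infixl 9 _[_↦_] _[_↦*_]
  _[_↦_] : State → 𝒳 → ℝ → State
  (ω [ x ↦ r ]) y = if does (em {y ≡ x}) then r else ω y

  -- Should a variable occur repeatedly in the tuple, its first entry counts.
  _[_↦*_] : ∀ {N} → State → Vec 𝒳 N → Vec ℝ N → State
  ω [ [] ↦* [] ]         = ω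
  ω [ x ∷ xs ↦* r ∷ rs ] = ω [ xs ↦* rs ] [ x ↦ r ]

  ⟦_⟧ₜ : Term → State → ℝ
  ⟦ var x ⟧ₜ ω   = ω x
  ⟦ 𝟎 ⟧ₜ ω       = 0#
  ⟦ 𝟏 ⟧ₜ ω       = 1#
  ⟦ θ ⊕ η ⟧ₜ ω   = ⟦ θ ⟧ₜ ω + ⟦ η ⟧ₜ ω
  ⟦ θ ⊗ η ⟧ₜ ω   = ⟦ θ ⟧ₜ ω * ⟦ η ⟧ₜ ω
  ⟦ ⊖ θ ⟧ₜ ω     = - ⟦ θ ⟧ₜ ω

  ⟦_⟧ₐ : Atom → Pred State 0ℓ
  ⟦ θ ≐ₜ η ⟧ₐ ω = ⟦ θ ⟧ₜ ω ≡ ⟦ η ⟧ₜ ω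
  ⟦ θ <ₜ η ⟧ₐ ω = ⟦ θ ⟧ₜ ω < ⟦ η ⟧ₜ ω

  ⟦_⟧ₗ : Literal → Pred State 0ℓ
  ⟦ pos p ⟧ₗ = ⟦ p ⟧ₐ
  ⟦ neg p ⟧ₗ = ∁ ⟦ p ⟧ₐ

  infix 4 _⊨_
  _⊨_ : State → FOFormula → Set
  ω ⊨ atom p      = ⟦ p ⟧ₐ ω
  ω ⊨ ¬ᶠ φ        = ¬ (ω ⊨ φ)
  ω ⊨ (φ ∧ᶠ ψ)    = ω ⊨ φ × ω ⊨ ψ
  ω ⊨ (φ ∨ᶠ ψ)    = ω ⊨ φ ⊎ ω ⊨ ψ
  ω ⊨ existsᶠ x φ = ∃ λ r → ω [ x ↦ r ] ⊨ φ
  ω ⊨ forallᶠ x φ = ∀ r → ω [ x ↦ r ] ⊨ φ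

  -- Continuity and differentiability refer to the restriction of f to [0,t].
  ContinuousOn : ℝ → (ℝ → ℝ) → Set
  ContinuousOn t f =
    ∀ s → 0# ≤ s → s ≤ t → ∀ ε → 0# < ε → ∃ λ δ → 0# < δ ×
      (∀ u → 0# ≤ u → u ≤ t → ∣ u - s ∣ < δ → ∣ f u - f s ∣ < ε)

  HasDerivativeAt : ℝ → (ℝ → ℝ) → ℝ → ℝ → Set
  HasDerivativeAt t f s d =
    ∀ ε → 0# < ε → ∃ λ δ → 0# < δ ×
      (∀ u → 0# ≤ u → u ≤ t → ∣ u - s ∣ < δ →
         ∣ (f u - f s) - d * (u - s) ∣ ≤ ε * ∣ u - s ∣)

  -- A curve [0,t] → ℝᴺ is given by a function on ℝ whose values off [0,t] are
  -- irrelevant; its continuity and its derivative are taken componentwise.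
  record Evolution {N : ℕ} (x : Vec 𝒳 N) (θ : Vec Term N) (ψ : FOFormula)
                   (ω ω′ : State) : Set where
    F : Vec ℝ N → Vec ℝ N
    F r = map (λ η → ⟦ η ⟧ₜ (ω [ x ↦* r ])) θ

    K : Pred (Vec ℝ N) 0ℓ
    K r = ω [ x ↦* r ] ⊨ ψ

    field
      off        : ∀ y → y ∉ x → ω′ y ≡ ω y
      t          : ℝ
      0≤t        : 0# ≤ t
      γ          : ℝ → Vec ℝ N
      continuous : ∀ i → ContinuousOn t (λ s → lookup (γ s) i)
      flow       : ∀ s → 0# < s → s < t → ∀ i →
                   HasDerivativeAt t (λ u → lookup (γ u) i) s (lookup (F (γ s)) i)
      start      : γ 0# ≡ map ω x
      end        : γ t ≡ map ω′ x
      domain     : ∀ s → 0# ≤ s → s ≤ t → K (γ s)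

  ⟦_⟧act : Act → Rel State 0ℓ
  ⟦ x :=* ⟧act ω ω′        = ∃ λ r → ω′ ≡ ω [ x ↦ r ]
  ⟦ x := θ ⟧act ω ω′       = ω′ ≡ ω [ x ↦ ⟦ θ ⟧ₜ ω ]
  ⟦ evolve x θ ψ ⟧act ω ω′ = Evolution x θ ψ ω ω′

  -- Denotations are predicates.  What gets quantified over, however, are
  -- Boolean-valued functions: by excluded middle they represent all sets of
  -- states, and unlike predicates they form a type small enough for the
  -- fixpoints below to be predicates of level 0 again.
  StateSet : Set
  StateSet = State → Bool

  ⌞_⌟ : StateSet → Pred State 0ℓ
  ⌞ Z ⌟ ω = T (Z ω)

  -- By Knaster and Tarski, the least and the greatest fixpoint if f is monotone.
  lfp gfp : (StateSet → Pred State 0ℓ) → Pred State 0ℓ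
  lfp f ω = ∀ Z → f Z ⊆ ⌞ Z ⌟ → ⌞ Z ⌟ ω
  gfp f ω = ∃ λ Z → ⌞ Z ⌟ ⊆ f Z × ⌞ Z ⌟ ω

  Valuation : Set
  Valuation = 𝒱 → StateSet

  value : Valuation → PVar → StateSet
  value V (pos X) = V X
  value V (neg X) = not ∘ V X

  -- The valuation is changed so that the (possibly complemented) variable gets
  -- the given value.
  infixl 9 _⟨_↦_⟩
  _⟨_↦_⟩ : Valuation → PVar → StateSet → Valuation
  (V ⟨ pos X ↦ Z ⟩) Y = if does (em {Y ≡ X}) then Z else V Y
  (V ⟨ neg X ↦ Z ⟩) Y = if does (em {Y ≡ X}) then not ∘ Z else V Y

  ⟦_⟧μ : μFormula → Valuation → Pred State 0ℓ
  ⟦ lit p ⟧μ V       = ⟦ p ⟧ₗ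
  ⟦ var X ⟧μ V       = ⌞ value V X ⌟
  ⟦ φ ∨ ψ ⟧μ V ω     = ⟦ φ ⟧μ V ω ⊎ ⟦ ψ ⟧μ V ω
  ⟦ φ ∧ ψ ⟧μ V ω     = ⟦ φ ⟧μ V ω × ⟦ ψ ⟧μ V ω
  ⟦ ⟨ a ⟩ φ ⟧μ V ω   = ∃ λ ω′ → ⟦ a ⟧act ω ω′ × ⟦ φ ⟧μ V ω′
  ⟦ [ a ] φ ⟧μ V ω   = ∀ ω′ → ⟦ a ⟧act ω ω′ → ⟦ φ ⟧μ V ω′
  ⟦ μ X ψ _ ⟧μ V     = lfp λ Z → ⟦ ψ ⟧μ (V ⟨ X ↦ Z ⟩)
  ⟦ ν X ψ _ ⟧μ V     = gfp λ Z → ⟦ ψ ⟧μ (V ⟨ X ↦ Z ⟩)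

  mutual
    ⟦_⟧ : dGL → Pred State 0ℓ
    ⟦ lit p ⟧     = ⟦ p ⟧ₗ
    ⟦ ¬ᵍ φ ⟧      = ∁ ⟦ φ ⟧
    ⟦ φ ∨ ψ ⟧ ω   = ⟦ φ ⟧ ω ⊎ ⟦ ψ ⟧ ω
    ⟦ ⟨ γ ⟩ φ ⟧   = ⟦ γ ⟧ᵍ ⟦ φ ⟧

    ⟦_⟧ᵍ : Game → Pred State 0ℓ → Pred State 0ℓ
    ⟦ act a ⟧ᵍ D ω     = ∃ λ ω′ → ⟦ a ⟧act ω ω′ × D ω′
    ⟦ test φ ⟧ᵍ D ω    = ⟦ φ ⟧ ω × D ω
    ⟦ γ₁ ∪ γ₂ ⟧ᵍ D ω   = ⟦ γ₁ ⟧ᵍ D ω ⊎ ⟦ γ₂ ⟧ᵍ D ω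
    ⟦ γ₁ ⨾ γ₂ ⟧ᵍ D     = ⟦ γ₁ ⟧ᵍ (⟦ γ₂ ⟧ᵍ D)
    ⟦ loop γ ⟧ᵍ D      = lfp λ Z ω → D ω ⊎ ⟦ γ ⟧ᵍ ⌞ Z ⌟ ω
    ⟦ dual γ ⟧ᵍ D      = ∁ (⟦ γ ⟧ᵍ (∁ D))

  -- The propositional variables are immaterial to a closed formula, so its
  -- truth is asked for under every valuation.
  SameStates : dGL → dLμ → Set
  SameStates φ ψ = ∀ (V : Valuation) → ⟦ φ ⟧ ≐ ⟦ proj₁ ψ ⟧μ V

{-# OPTIONS --safe #-}
-- A dGL game is played by Angel and by Demon; a μ-calculus formula describes the
-- winning region of either, a repetition becoming a fixpoint in a fresh
-- propositional variable.  Conversely, the game evaluating a μ-formula records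
-- in a fresh object variable c which propositional variable has been reached:
-- an occurrence of X is the assignment c := n for the number n of X, and μX.ψ is
-- the game c := n; (?c = n; ψ)*; ?c ≠ n.  Thus a repetition can be left from
-- within towards any enclosing fixpoint, and the value of X is the slice c = n
-- of the winning region.
module Submission where

open import Defs
open import Level using (0ℓ)
open import Algebra.Bundles using (CommutativeRing)
import Algebra.Properties.Ring as RingProperties
open import Axiom.ExcludedMiddle using (ExcludedMiddle)
open import Axiom.Extensionality.Propositional using (Extensionality)
open import Data.Bool using (true; false; T; not; if_then_else_)
open import Data.Bool.Properties using (not-involutive)
open import Data.Empty using (⊥-elim)
open import Data.List using (List; []; _∷_; _++_)
open import Data.List.Membership.Propositional using (_∈_) renaming (_∉_ to _∉ˡ_)
open import Data.List.Membership.Propositional.Properties using (∈-++⁺ˡ; ∈-++⁺ʳ)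
open import Data.List.Relation.Unary.Any using (here; there)
open import Data.Nat as ℕ using (ℕ; zero; suc)
import Data.Nat.Properties as ℕ
open import Data.Product using (Σ; ∃; _×_; _,_; proj₁; proj₂)
open import Data.Sum using (_⊎_; inj₁; inj₂; [_,_]′)
open import Data.Unit using (tt)
open import Data.Vec using (Vec; []; _∷_; map; lookup; toList)
open import Data.Vec.Membership.Propositional using (_∉_)
open import Function using (_∘_; id)
open import Relation.Binary using (IsTotalOrder)
open import Relation.Binary.PropositionalEquality
  using (_≡_; _≢_; refl; sym; trans; cong; cong₂; subst; subst₂)
open import Relation.Nullary using (¬_; yes; no; contradiction)
open import Relation.Nullary.Decidable using (⌊_⌋; toWitness; fromWitness; decidable-stable)
open import Relation.Unary using (Pred; ∁; _⊆_; _≐_)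
open import Relation.Unary.Properties using (≐-sym; ≐-trans)

-- Natural numbers as elements of an ordered field

module Naturals (ℛ : RealField) where

  open RealField ℛ
  open IsTotalOrder isTotalOrder using (antisym; total)
    renaming (refl to ≤-refl; trans to ≤-trans)

  commutativeRing : CommutativeRing 0ℓ 0ℓ
  commutativeRing = record { isCommutativeRing = isCommutativeRing }

  open CommutativeRing commutativeRing using (ring; +-comm; +-identityˡ; +-identityʳ; -‿inverseʳ)
  open RingProperties ring using (-1*x≈-x; -‿involutive; +-cancelˡ)

  0≤1 : 0# ≤ 1#
  0≤1 with total 0# 1#
  ... | inj₁ p = p
  ... | inj₂ 1≤0 = subst (0# ≤_) -1*-1≡1 (*-nonneg 0≤-1 0≤-1)
    where
    0≤-1 : 0# ≤ - 1#
    0≤-1 = subst₂ _≤_ (-‿inverseʳ 1#) (+-identityˡ (- 1#)) (+-monoˡ-≤ (- 1#) 1≤0)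
    -1*-1≡1 : (- 1#) * (- 1#) ≡ 1#
    -1*-1≡1 = trans (-1*x≈-x (- 1#)) (-‿involutive 1#)

  fromℕ : ℕ → ℝ
  fromℕ zero    = 0#
  fromℕ (suc n) = fromℕ n + 1#

  x≤x+1 : ∀ x → x ≤ x + 1#
  x≤x+1 x = subst₂ _≤_ (+-identityˡ x) (+-comm 1# x) (+-monoˡ-≤ x 0≤1)

  fromℕ-mono : ∀ {m n} → m ℕ.≤′ n → fromℕ m ≤ fromℕ n
  fromℕ-mono ℕ.≤′-refl     = ≤-refl
  fromℕ-mono (ℕ.≤′-step p) = ≤-trans (fromℕ-mono p) (x≤x+1 _)

  -- Propositional variables are told apart by the real numbers stored in `c`. An equation would, by
  -- monotonicity, squeeze `fromℕ n + 1#` below `fromℕ n`, and cancellation would give `0# ≡ 1#`.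
  fromℕ-distinct : ∀ {m n} → m ℕ.< n → fromℕ m ≢ fromℕ n
  fromℕ-distinct {m} {suc n} (ℕ.s≤s m≤n) eq =
    0≢1 (+-cancelˡ (fromℕ n) 0# 1# (trans (+-identityʳ _) n≡n+1))
    where
    n≡n+1 : fromℕ n ≡ fromℕ n + 1#
    n≡n+1 = antisym (x≤x+1 _) (subst (_≤ fromℕ n) eq (fromℕ-mono (ℕ.≤⇒≤′ m≤n)))

module Equiexpressiveness (em : ExcludedMiddle 0ℓ) (ext : Extensionality 0ℓ 0ℓ)
                          (𝒳 𝒱 : Set) (ℛ : RealField) where

  open Semantics em 𝒳 𝒱 ℛ
  open RealField ℛ using (ℝ)
  open Naturals ℛ using (fromℕ; fromℕ-distinct)

  stable : {A : Set} → ¬ ¬ A → A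
  stable = decidable-stable em

  -- Sets of states and fixpoints

  T-not⁺ : ∀ b → ¬ T b → T (not b)
  T-not⁺ false _  = tt
  T-not⁺ true  ¬b = ¬b tt

  T-not⁻ : ∀ b → T (not b) → ¬ T b
  T-not⁻ false _ ()

  -- Fixpoints range over `StateSet`, so a predicate has to be made Boolean, by excluded middle,
  -- before it can serve as a candidate pre-fixpoint.
  setOf : Pred State 0ℓ → StateSet
  setOf P ω = ⌊ em {P ω} ⌋

  not-not : ∀ (Z : StateSet) → not ∘ not ∘ Z ≡ Z
  not-not Z = ext λ ω → not-involutive (Z ω)

  lfp-mono : ∀ {f g} → (∀ Z → f Z ⊆ g Z) → lfp f ⊆ lfp g
  lfp-mono f⊆g p Z closed = p Z (closed ∘ f⊆g Z)

  gfp-mono : ∀ {f g} → (∀ Z → f Z ⊆ g Z) → gfp f ⊆ gfp g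
  gfp-mono f⊆g (Z , post , p) = Z , f⊆g Z ∘ post , p

  -- Complementation turns pre-fixpoints of `f` into post-fixpoints of `g` and conversely. Demon's
  -- repetitions and the formulas `ν` are reduced to least fixpoints in this way.
  gfp≐∁lfp : ∀ {f g} → (∀ Z → g Z ≐ ∁ (f (not ∘ Z))) → gfp g ≐ ∁ (lfp f)
  gfp≐∁lfp {f} {g} dual-body = to , from
    where
    to : gfp g ⊆ ∁ (lfp f)
    to (Z , post , p) q = T-not⁻ (Z _) (q (not ∘ Z) closed) p
      where
      closed : f (not ∘ Z) ⊆ ⌞ not ∘ Z ⌟
      closed r = T-not⁺ (Z _) λ z → proj₁ (dual-body Z) (post z) r
    from : ∁ (lfp f) ⊆ gfp g
    from {ω} ¬p = stable λ ¬q → ¬p λ Z closed → stable λ ¬z →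
      ¬q ( not ∘ Z
         , (λ {ω′} z → proj₂ (dual-body (not ∘ Z))
              (T-not⁻ (Z ω′) z ∘ closed ∘ subst (λ Z′ → f Z′ ω′) (not-not Z)))
         , T-not⁺ (Z ω) ¬z)

  -- Valuations

  value-updated : ∀ V X Z → value (V ⟨ X ↦ Z ⟩) X ≡ Z
  value-updated V (pos X) Z with em {X ≡ X}
  ... | yes _  = refl
  ... | no X≢X = contradiction refl X≢X
  value-updated V (neg X) Z with em {X ≡ X}
  ... | yes _  = not-not Z
  ... | no X≢X = contradiction refl X≢X

  value-unchanged : ∀ V {X Y} Z → Y ≢ X → Y ≢ complement X →
                    value (V ⟨ X ↦ Z ⟩) Y ≡ value V Y
  value-unchanged V {pos X} {pos Y} Z Y≢X _ with em {Y ≡ X}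
  ... | yes refl = contradiction refl Y≢X
  ... | no _     = refl
  value-unchanged V {pos X} {neg Y} Z _ Y≢X̄ with em {Y ≡ X}
  ... | yes refl = contradiction refl Y≢X̄
  ... | no _     = refl
  value-unchanged V {neg X} {pos Y} Z _ Y≢X̄ with em {Y ≡ X}
  ... | yes refl = contradiction refl Y≢X̄
  ... | no _     = refl
  value-unchanged V {neg X} {neg Y} Z Y≢X _ with em {Y ≡ X}
  ... | yes refl = contradiction refl Y≢X
  ... | no _     = refl

  Free⇒Mentions : ∀ {X} φ → Free X φ → Mentions X φ
  Free⇒Mentions (var Y)   p        = p
  Free⇒Mentions (φ ∨ ψ)   (inj₁ p) = inj₁ (Free⇒Mentions φ p)
  Free⇒Mentions (φ ∨ ψ)   (inj₂ p) = inj₂ (Free⇒Mentions ψ p)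
  Free⇒Mentions (φ ∧ ψ)   (inj₁ p) = inj₁ (Free⇒Mentions φ p)
  Free⇒Mentions (φ ∧ ψ)   (inj₂ p) = inj₂ (Free⇒Mentions ψ p)
  Free⇒Mentions (⟨ a ⟩ φ) p        = Free⇒Mentions φ p
  Free⇒Mentions ([ a ] φ) p        = Free⇒Mentions φ p
  Free⇒Mentions (μ Y ψ _) (_ , p)  = inj₂ (Free⇒Mentions ψ p)
  Free⇒Mentions (ν Y ψ _) (_ , p)  = inj₂ (Free⇒Mentions ψ p)

  Free⇒≢complement : ∀ {X Y} ψ → ¬ Mentions (complement X) ψ → Free Y ψ → Y ≢ complement X
  Free⇒≢complement ψ ¬m free refl = ¬m (Free⇒Mentions ψ free)

  -- Inclusion is asked separately of a variable and of its complement: if both are free in `φ`, the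
  -- valuations agree there. Hence formulas are monotone whatever the signs of their variables.
  _≤[_]_ : Valuation → μFormula → Valuation → Set
  V ≤[ φ ] V′ = ∀ {Y} → Free Y φ → ⌞ value V Y ⌟ ⊆ ⌞ value V′ Y ⌟

  update-mono : ∀ {V V′ X Z} ψ → ¬ Mentions (complement X) ψ →
                (∀ {Y} → Y ≢ X × Free Y ψ → ⌞ value V Y ⌟ ⊆ ⌞ value V′ Y ⌟) →
                (V ⟨ X ↦ Z ⟩) ≤[ ψ ] (V′ ⟨ X ↦ Z ⟩)
  update-mono {V} {V′} {X} {Z} ψ ¬m le {Y} free {ω} z with em {Y ≡ X}
  ... | yes refl = subst (λ S → ⌞ S ⌟ ω)
                     (trans (value-updated V X Z) (sym (value-updated V′ X Z))) z
  ... | no Y≢X   = subst (λ S → ⌞ S ⌟ ω) (sym (value-unchanged V′ Z Y≢X Y≢X̄))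
                     (le (Y≢X , free) (subst (λ S → ⌞ S ⌟ ω) (value-unchanged V Z Y≢X Y≢X̄) z))
    where Y≢X̄ = Free⇒≢complement {X} ψ ¬m free

  -- Applied in both directions, this shows that a denotation depends only on the values of the free
  -- variables, so that updating a fresh variable has no effect.
  ⟦⟧μ-mono : ∀ φ {V V′} → V ≤[ φ ] V′ → ⟦ φ ⟧μ V ⊆ ⟦ φ ⟧μ V′
  ⟦⟧μ-mono (lit p)    le q            = q
  ⟦⟧μ-mono (var X)    le q            = le refl q
  ⟦⟧μ-mono (φ ∨ ψ)    le (inj₁ q)     = inj₁ (⟦⟧μ-mono φ (le ∘ inj₁) q)
  ⟦⟧μ-mono (φ ∨ ψ)    le (inj₂ q)     = inj₂ (⟦⟧μ-mono ψ (le ∘ inj₂) q)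
  ⟦⟧μ-mono (φ ∧ ψ)    le (q , r)      = ⟦⟧μ-mono φ (le ∘ inj₁) q , ⟦⟧μ-mono ψ (le ∘ inj₂) r
  ⟦⟧μ-mono (⟨ a ⟩ φ)  le (ω′ , s , q) = ω′ , s , ⟦⟧μ-mono φ le q
  ⟦⟧μ-mono ([ a ] φ)  le q ω′ s       = ⟦⟧μ-mono φ le (q ω′ s)
  ⟦⟧μ-mono (μ X ψ ¬m) le = lfp-mono λ Z → ⟦⟧μ-mono ψ (update-mono ψ ¬m le)
  ⟦⟧μ-mono (ν X ψ ¬m) le = gfp-mono λ Z → ⟦⟧μ-mono ψ (update-mono ψ ¬m le)

  base : PVar → 𝒱
  base (pos X) = X
  base (neg X) = X

  base-complement : ∀ X → base (complement X) ≡ base X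
  base-complement (pos X) = refl
  base-complement (neg X) = refl

  -- Signs are dropped because an update of a variable changes its complement as well.
  pvars : μFormula → List 𝒱
  pvars (lit p)   = []
  pvars (var X)   = base X ∷ []
  pvars (φ ∨ ψ)   = pvars φ ++ pvars ψ
  pvars (φ ∧ ψ)   = pvars φ ++ pvars ψ
  pvars (⟨ a ⟩ φ) = pvars φ
  pvars ([ a ] φ) = pvars φ
  pvars (μ X ψ _) = pvars ψ
  pvars (ν X ψ _) = pvars ψ

  Free⇒∈pvars : ∀ {X} φ → Free X φ → base X ∈ pvars φ
  Free⇒∈pvars (var Y)   refl     = here refl
  Free⇒∈pvars (φ ∨ ψ)   (inj₁ p) = ∈-++⁺ˡ (Free⇒∈pvars φ p)
  Free⇒∈pvars (φ ∨ ψ)   (inj₂ p) = ∈-++⁺ʳ (pvars φ) (Free⇒∈pvars ψ p)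
  Free⇒∈pvars (φ ∧ ψ)   (inj₁ p) = ∈-++⁺ˡ (Free⇒∈pvars φ p)
  Free⇒∈pvars (φ ∧ ψ)   (inj₂ p) = ∈-++⁺ʳ (pvars φ) (Free⇒∈pvars ψ p)
  Free⇒∈pvars (⟨ a ⟩ φ) p        = Free⇒∈pvars φ p
  Free⇒∈pvars ([ a ] φ) p        = Free⇒∈pvars φ p
  Free⇒∈pvars (μ Y ψ _) (_ , p)  = Free⇒∈pvars ψ p
  Free⇒∈pvars (ν Y ψ _) (_ , p)  = Free⇒∈pvars ψ p

  ⟦⟧μ-update-fresh : ∀ φ V {X} Z → base X ∉ˡ pvars φ → ⟦ φ ⟧μ (V ⟨ X ↦ Z ⟩) ≐ ⟦ φ ⟧μ V
  ⟦⟧μ-update-fresh φ V {X} Z X∉φ =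
    ⟦⟧μ-mono φ (λ free {ω} → subst (λ S → ⌞ S ⌟ ω) (unchanged free)) ,
    ⟦⟧μ-mono φ (λ free {ω} → subst (λ S → ⌞ S ⌟ ω) (sym (unchanged free)))
    where
    unchanged : ∀ {Y} → Free Y φ → value (V ⟨ X ↦ Z ⟩) Y ≡ value V Y
    unchanged {Y} free = value-unchanged V {X} {Y} Z
      (λ { refl → X∉φ (Free⇒∈pvars φ free) })
      (λ { refl → X∉φ (subst (_∈ pvars φ) (base-complement X) (Free⇒∈pvars φ free)) })

  -- From games to μ-formulas

  data Player : Set where
    angel demon : Player

  opponent : Player → Player
  opponent angel = demon
  opponent demon = angel

  truth : Player → dGL → Pred State 0ℓ
  truth angel φ = ⟦ φ ⟧
  truth demon φ = ∁ ⟦ φ ⟧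

  -- `win demon γ` unfolds to the meaning of `dual γ`, which makes `dual` an exchange of the
  -- players.
  win : Player → Game → Pred State 0ℓ → Pred State 0ℓ
  win angel γ D = ⟦ γ ⟧ᵍ D
  win demon γ D = ∁ (⟦ γ ⟧ᵍ (∁ D))

  ⟦⟧ᵍ-mono : ∀ γ {D D′} → D ⊆ D′ → ⟦ γ ⟧ᵍ D ⊆ ⟦ γ ⟧ᵍ D′
  ⟦⟧ᵍ-mono (act a)  le (ω′ , s , p) = ω′ , s , le p
  ⟦⟧ᵍ-mono (test φ) le (q , p)      = q , le p
  ⟦⟧ᵍ-mono (γ ∪ δ)  le (inj₁ p)     = inj₁ (⟦⟧ᵍ-mono γ le p)
  ⟦⟧ᵍ-mono (γ ∪ δ)  le (inj₂ p)     = inj₂ (⟦⟧ᵍ-mono δ le p)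
  ⟦⟧ᵍ-mono (γ ⨾ δ)  le              = ⟦⟧ᵍ-mono γ (⟦⟧ᵍ-mono δ le)
  ⟦⟧ᵍ-mono (loop γ) le              = lfp-mono λ Z → λ { (inj₁ p) → inj₁ (le p) ; (inj₂ p) → inj₂ p }
  ⟦⟧ᵍ-mono (dual γ) le p q          = p (⟦⟧ᵍ-mono γ (λ ¬d′ d → ¬d′ (le d)) q)

  win-mono : ∀ i γ {D D′} → D ⊆ D′ → win i γ D ⊆ win i γ D′
  win-mono angel γ le     = ⟦⟧ᵍ-mono γ le
  win-mono demon γ le p q = p (⟦⟧ᵍ-mono γ (λ ¬d′ d → ¬d′ (le d)) q)

  win-cong : ∀ i γ {D D′} → D ≐ D′ → win i γ D ≐ win i γ D′
  win-cong i γ (le , ge) = win-mono i γ le , win-mono i γ ge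

  -- Where Demon's goal is itself a complement, as for a formula read for Demon or after a second
  -- game, the double negation hidden in `win demon` cancels.
  win-demon-∁ : ∀ γ {D E} → D ≐ ∁ E → win demon γ D ≐ ∁ (⟦ γ ⟧ᵍ E)
  win-demon-∁ γ (to , from) =
    (λ p q → p (⟦⟧ᵍ-mono γ (λ e d → to d e) q)) ,
    (λ p q → p (⟦⟧ᵍ-mono γ (λ ¬d → stable (¬d ∘ from)) q))

  -- Carried along with every formula built from a game, this supplies the side condition of `μ` and
  -- `ν` when a repetition is translated.
  Positive : μFormula → Set
  Positive φ = ∀ X → ¬ Mentions (neg X) φ

  μFormula⁺ : Set
  μFormula⁺ = Σ μFormula Positive

  ⟦_⟧⁺ : μFormula⁺ → Valuation → Pred State 0ℓ
  ⟦ φ , _ ⟧⁺ = ⟦ φ ⟧μ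

  literal : Player → Literal → μFormula⁺
  literal angel p       = lit p , λ _ ()
  literal demon (pos p) = lit (neg p) , λ _ ()
  literal demon (neg p) = lit (pos p) , λ _ ()

  variable⁺ : 𝒱 → μFormula⁺
  variable⁺ X = var (pos X) , λ _ ()

  choice : Player → μFormula⁺ → μFormula⁺ → μFormula⁺
  choice angel (φ , p) (ψ , q) = (φ ∨ ψ) , λ X → [ p X , q X ]′
  choice demon (φ , p) (ψ , q) = (φ ∧ ψ) , λ X → [ p X , q X ]′

  move : Player → Act → μFormula⁺ → μFormula⁺
  move angel a (φ , p) = (⟨ a ⟩ φ) , p
  move demon a (φ , p) = ([ a ] φ) , p

  fixpoint : Player → 𝒱 → μFormula⁺ → μFormula⁺
  fixpoint angel X (φ , p) = μ (pos X) φ (p X) , λ { Y (inj₂ m) → p Y m }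
  fixpoint demon X (φ , p) = ν (pos X) φ (p X) , λ { Y (inj₂ m) → p Y m }

  Free-choice : ∀ i φ ψ {Y} → Free Y (proj₁ (choice i φ ψ)) → Free Y (proj₁ φ) ⊎ Free Y (proj₁ ψ)
  Free-choice angel φ ψ = id
  Free-choice demon φ ψ = id

  Free-fixpoint : ∀ i X φ {Y} → Free Y (proj₁ (fixpoint i X φ)) → Y ≢ pos X × Free Y (proj₁ φ)
  Free-fixpoint angel X φ = id
  Free-fixpoint demon X φ = id

  module FromGames (𝒱-infinite : Infinite 𝒱) where

    -- Avoiding the continuation `ψ` is enough: tests inside the repeated game become closed
    -- formulas, and an inner repetition chooses its variable fresh for its own continuation, so it
    -- captures nothing that occurs there.
    freshFor : μFormula⁺ → 𝒱
    freshFor (ψ , _) = proj₁ (𝒱-infinite (pvars ψ))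

    continuation : ∀ ψ V Z → ⟦ ψ ⟧⁺ (V ⟨ pos (freshFor ψ) ↦ Z ⟩) ≐ ⟦ ψ ⟧⁺ V
    continuation (ψ , _) V Z = ⟦⟧μ-update-fresh ψ V {pos _} Z (proj₂ (𝒱-infinite (pvars ψ)))

    mutual
      formula : Player → dGL → μFormula⁺
      formula i (lit p)   = literal i p
      formula i (¬ᵍ φ)    = formula (opponent i) φ
      formula i (φ ∨ ψ)   = choice i (formula i φ) (formula i ψ)
      formula i (⟨ γ ⟩ φ) = strategy i γ (formula i φ)

      -- A translation in continuation-passing style: `ψ` is the goal of player `i` after the game,
      -- the result describes where `i` can force it. Negation and `dual` swap the players, so that
      -- only literals are ever negated.
      strategy : Player → Game → μFormula⁺ → μFormula⁺
      strategy i (act a)  ψ = move i a ψ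
      -- A test is a conjunction for Angel. Demon wins it if `φ` fails, which is what
      -- `formula demon φ` expresses, or if `ψ` holds.
      strategy i (test φ) ψ = choice (opponent i) (formula i φ) ψ
      strategy i (γ ∪ δ)  ψ = choice i (strategy i γ ψ) (strategy i δ ψ)
      strategy i (γ ⨾ δ)  ψ = strategy i γ (strategy i δ ψ)
      strategy i (loop γ) ψ = fixpoint i X (choice i ψ (strategy i γ (variable⁺ X)))
        where X = freshFor ψ
      strategy i (dual γ) ψ = strategy (opponent i) γ ψ

    mutual
      formula-closed : ∀ i φ {Y} → ¬ Free Y (proj₁ (formula i φ))
      formula-closed angel (lit p) ()
      formula-closed demon (lit (pos p)) ()
      formula-closed demon (lit (neg p)) ()
      formula-closed i (¬ᵍ φ) free = formula-closed (opponent i) φ free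
      formula-closed i (φ ∨ ψ) =
        [ formula-closed i φ , formula-closed i ψ ]′ ∘ Free-choice i (formula i φ) (formula i ψ)
      formula-closed i (⟨ γ ⟩ φ) free =
        formula-closed i φ (Free-strategy i γ (formula i φ) free)

      Free-strategy : ∀ i γ ψ {Y} → Free Y (proj₁ (strategy i γ ψ)) → Free Y (proj₁ ψ)
      Free-strategy angel (act a) ψ = id
      Free-strategy demon (act a) ψ = id
      Free-strategy i (test φ) ψ =
        [ ⊥-elim ∘ formula-closed i φ , id ]′ ∘ Free-choice (opponent i) (formula i φ) ψ
      Free-strategy i (γ ∪ δ) ψ =
        [ Free-strategy i γ ψ , Free-strategy i δ ψ ]′ ∘
        Free-choice i (strategy i γ ψ) (strategy i δ ψ)
      Free-strategy i (γ ⨾ δ) ψ = Free-strategy i δ ψ ∘ Free-strategy i γ (strategy i δ ψ)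
      Free-strategy i (loop γ) ψ free
        with Y≢X , free′ ← Free-fixpoint i (freshFor ψ) _ free =
        [ id , (λ q → contradiction (Free-strategy i γ (variable⁺ _) q) Y≢X) ]′
          (Free-choice i ψ (strategy i γ (variable⁺ _)) free′)
      Free-strategy i (dual γ) ψ = Free-strategy (opponent i) γ ψ

    mutual
      formula-correct : ∀ i φ V → ⟦ formula i φ ⟧⁺ V ≐ truth i φ
      formula-correct angel (lit p) V = id , id
      formula-correct demon (lit (pos p)) V = id , id
      formula-correct demon (lit (neg p)) V = (λ q ¬q → ¬q q) , stable
      formula-correct angel (¬ᵍ φ) V = formula-correct demon φ V
      formula-correct demon (¬ᵍ φ) V with to , from ← formula-correct angel φ V =
        (λ q ¬q → ¬q (to q)) , λ q → from (stable q)
      formula-correct angel (φ ∨ ψ) V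
        with to , from ← formula-correct angel φ V | to′ , from′ ← formula-correct angel ψ V =
        (λ { (inj₁ p) → inj₁ (to p) ; (inj₂ p) → inj₂ (to′ p) }) ,
        (λ { (inj₁ p) → inj₁ (from p) ; (inj₂ p) → inj₂ (from′ p) })
      formula-correct demon (φ ∨ ψ) V
        with to , from ← formula-correct demon φ V | to′ , from′ ← formula-correct demon ψ V =
        (λ { (p , q) → [ to p , to′ q ]′ }) ,
        (λ p → from (p ∘ inj₁) , from′ (p ∘ inj₂))
      formula-correct angel (⟨ γ ⟩ φ) V =
        ≐-trans (strategy-correct angel γ (formula angel φ) V)
                (win-cong angel γ (formula-correct angel φ V))
      formula-correct demon (⟨ γ ⟩ φ) V =
        ≐-trans (strategy-correct demon γ (formula demon φ) V)
                (win-demon-∁ γ (formula-correct demon φ V))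

      strategy-correct : ∀ i γ ψ V → ⟦ strategy i γ ψ ⟧⁺ V ≐ win i γ (⟦ ψ ⟧⁺ V)
      strategy-correct angel (act a) ψ V = id , id
      strategy-correct demon (act a) ψ V =
        (λ { p (ω′ , s , ¬q) → ¬q (p ω′ s) }) , λ p ω′ s → stable λ ¬q → p (ω′ , s , ¬q)
      strategy-correct angel (test φ) ψ V with to , from ← formula-correct angel φ V =
        (λ { (p , q) → to p , q }) , (λ { (p , q) → from p , q })
      strategy-correct demon (test φ) ψ V with to , from ← formula-correct demon φ V =
        (λ { (inj₁ p) (q , _) → to p q ; (inj₂ p) (_ , q) → q p }) ,
        (λ p → stable λ ¬q → ¬q (inj₁ (from λ r → p (r , ¬q ∘ inj₂))))
      strategy-correct angel (γ ∪ δ) ψ V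
        with to , from ← strategy-correct angel γ ψ V | to′ , from′ ← strategy-correct angel δ ψ V =
        (λ { (inj₁ p) → inj₁ (to p) ; (inj₂ p) → inj₂ (to′ p) }) ,
        (λ { (inj₁ p) → inj₁ (from p) ; (inj₂ p) → inj₂ (from′ p) })
      strategy-correct demon (γ ∪ δ) ψ V
        with to , from ← strategy-correct demon γ ψ V | to′ , from′ ← strategy-correct demon δ ψ V =
        (λ { (p , q) → [ to p , to′ q ]′ }) ,
        (λ p → from (p ∘ inj₁) , from′ (p ∘ inj₂))
      strategy-correct angel (γ ⨾ δ) ψ V =
        ≐-trans (strategy-correct angel γ (strategy angel δ ψ) V)
                (win-cong angel γ (strategy-correct angel δ ψ V))
      strategy-correct demon (γ ⨾ δ) ψ V =
        ≐-trans (strategy-correct demon γ (strategy demon δ ψ) V)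
                (win-demon-∁ γ (strategy-correct demon δ ψ V))
      strategy-correct angel (loop γ) ψ V =
        lfp-mono (λ Z → λ { (inj₁ p) → inj₁ (proj₁ (continuation ψ V Z) p)
                          ; (inj₂ p) → inj₂ (proj₁ (iteration angel γ ψ V Z) p) }) ,
        lfp-mono (λ Z → λ { (inj₁ p) → inj₁ (proj₂ (continuation ψ V Z) p)
                          ; (inj₂ p) → inj₂ (proj₂ (iteration angel γ ψ V Z) p) })
      -- The body for Demon at `Z` is the complement of the loop's body at the complement of `Z`,
      -- the loop being played for the complement of `ψ`.
      strategy-correct demon (loop γ) ψ V = gfp≐∁lfp λ Z →
        (λ { (p , q) (inj₁ r) → r (proj₁ (continuation ψ V Z) p)
           ; (p , q) (inj₂ r) → proj₁ (iteration demon γ ψ V Z) q (⟦⟧ᵍ-mono γ (T-not⁻ (Z _)) r) }) ,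
        (λ p → proj₂ (continuation ψ V Z) (stable (p ∘ inj₁)) ,
               proj₂ (iteration demon γ ψ V Z) (p ∘ inj₂ ∘ ⟦⟧ᵍ-mono γ (T-not⁺ (Z _))))
      strategy-correct angel (dual γ) ψ V = strategy-correct demon γ ψ V
      strategy-correct demon (dual γ) ψ V with to , from ← strategy-correct angel γ ψ V =
        (λ p q → q (⟦⟧ᵍ-mono γ (λ r s → s r) (to p))) ,
        (λ p → from (⟦⟧ᵍ-mono γ stable (stable p)))

      -- This is correctness of `γ` for the continuation `X` when `X` denotes the iterate `Z`.
      -- Together with `continuation` it matches the body of the translated fixpoint with that of
      -- the loop at every `Z`.
      iteration : ∀ i γ ψ V Z → let X = freshFor ψ in
                  ⟦ strategy i γ (variable⁺ X) ⟧⁺ (V ⟨ pos X ↦ Z ⟩) ≐ win i γ ⌞ Z ⌟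
      iteration i γ ψ V Z =
        subst (λ S → ⟦ strategy i γ (variable⁺ X) ⟧⁺ (V ⟨ pos X ↦ Z ⟩) ≐ win i γ ⌞ S ⌟)
              (value-updated V (pos X) Z) (strategy-correct i γ (variable⁺ X) _)
        where X = freshFor ψ

    dGL⇒dLμ : ∀ φ → ∃ λ (ψ : dLμ) → SameStates φ ψ
    dGL⇒dLμ φ = (proj₁ (formula angel φ) , λ Y → formula-closed angel φ) ,
                λ V → ≐-sym (formula-correct angel φ V)

  -- From μ-formulas to games

  updated : ∀ ω x r → (ω [ x ↦ r ]) x ≡ r
  updated ω x r with em {x ≡ x}
  ... | yes _  = refl
  ... | no x≢x = contradiction refl x≢x

  unchanged : ∀ ω {x y} r → y ≢ x → (ω [ x ↦ r ]) y ≡ ω y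
  unchanged ω {x} {y} r y≢x with em {y ≡ x}
  ... | yes y≡x = contradiction y≡x y≢x
  ... | no _    = refl

  update-twice : ∀ ω x r s → ω [ x ↦ r ] [ x ↦ s ] ≡ ω [ x ↦ s ]
  update-twice ω x r s = ext pointwise
    where
    pointwise : ∀ y → (ω [ x ↦ r ] [ x ↦ s ]) y ≡ (ω [ x ↦ s ]) y
    pointwise y with em {y ≡ x}
    ... | yes _ = refl
    ... | no _  = refl

  update-id : ∀ ω x → ω [ x ↦ ω x ] ≡ ω
  update-id ω x = ext pointwise
    where
    pointwise : ∀ y → (ω [ x ↦ ω x ]) y ≡ ω y
    pointwise y with em {y ≡ x}
    ... | yes refl = refl
    ... | no _     = refl

  update-restore : ∀ ω x r → ω [ x ↦ r ] [ x ↦ ω x ] ≡ ω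
  update-restore ω x r = trans (update-twice ω x r (ω x)) (update-id ω x)

  update-comm : ∀ ω {x y} r s → x ≢ y → ω [ x ↦ r ] [ y ↦ s ] ≡ ω [ y ↦ s ] [ x ↦ r ]
  update-comm ω {x} {y} r s x≢y = ext pointwise
    where
    pointwise : ∀ z → (ω [ x ↦ r ] [ y ↦ s ]) z ≡ (ω [ y ↦ s ] [ x ↦ r ]) z
    pointwise z with em {z ≡ y} | em {z ≡ x}
    ... | yes refl | yes refl = contradiction refl x≢y
    ... | yes _    | no _     = refl
    ... | no _     | yes _    = refl
    ... | no _     | no _     = refl

  -- The object variables of formulas and actions

  termVars : Term → List 𝒳
  termVars (var x) = x ∷ []
  termVars 𝟎       = []
  termVars 𝟏       = []
  termVars (θ ⊕ η) = termVars θ ++ termVars η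
  termVars (θ ⊗ η) = termVars θ ++ termVars η
  termVars (⊖ θ)   = termVars θ

  termsVars : ∀ {N} → Vec Term N → List 𝒳
  termsVars []       = []
  termsVars (θ ∷ θs) = termVars θ ++ termsVars θs

  atomVars : Atom → List 𝒳
  atomVars (θ ≐ₜ η) = termVars θ ++ termVars η
  atomVars (θ <ₜ η) = termVars θ ++ termVars η

  literalVars : Literal → List 𝒳
  literalVars (pos p) = atomVars p
  literalVars (neg p) = atomVars p

  -- Bound variables are listed too: an update of `c` commutes with that of a quantified variable
  -- only if the two differ.
  foVars : FOFormula → List 𝒳
  foVars (atom p)      = atomVars p
  foVars (¬ᶠ φ)        = foVars φ
  foVars (φ ∧ᶠ ψ)      = foVars φ ++ foVars ψ
  foVars (φ ∨ᶠ ψ)      = foVars φ ++ foVars ψ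
  foVars (existsᶠ x φ) = x ∷ foVars φ
  foVars (forallᶠ x φ) = x ∷ foVars φ

  actVars : Act → List 𝒳
  actVars (x :=*)        = x ∷ []
  actVars (x := θ)       = x ∷ termVars θ
  actVars (evolve x θ ψ) = toList x ++ termsVars θ ++ foVars ψ

  vars : μFormula → List 𝒳
  vars (lit p)   = literalVars p
  vars (var X)   = []
  vars (φ ∨ ψ)   = vars φ ++ vars ψ
  vars (φ ∧ ψ)   = vars φ ++ vars ψ
  vars (⟨ a ⟩ φ) = actVars a ++ vars φ
  vars ([ a ] φ) = actVars a ++ vars φ
  vars (μ X ψ _) = vars ψ
  vars (ν X ψ _) = vars ψ

  ∉-++⁻ˡ : ∀ {x : 𝒳} xs {ys} → x ∉ˡ xs ++ ys → x ∉ˡ xs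
  ∉-++⁻ˡ xs x∉ = x∉ ∘ ∈-++⁺ˡ

  ∉-++⁻ʳ : ∀ {x : 𝒳} xs {ys} → x ∉ˡ xs ++ ys → x ∉ˡ ys
  ∉-++⁻ʳ xs x∉ = x∉ ∘ ∈-++⁺ʳ xs

  numeral : ℕ → Term
  numeral zero    = 𝟎
  numeral (suc n) = numeral n ⊕ 𝟏

  ⟦numeral⟧ : ∀ n ω → ⟦ numeral n ⟧ₜ ω ≡ fromℕ n
  ⟦numeral⟧ zero    ω = refl
  ⟦numeral⟧ (suc n) ω = cong (λ r → RealField._+_ ℛ r (RealField.1# ℛ)) (⟦numeral⟧ n ω)

  module ToGames (c : 𝒳) where

    -- Independence of a variable `c` that does not occur

    ⟦⟧ₜ-shift : ∀ θ ω r → c ∉ˡ termVars θ → ⟦ θ ⟧ₜ (ω [ c ↦ r ]) ≡ ⟦ θ ⟧ₜ ω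
    ⟦⟧ₜ-shift (var x) ω r c∉ = unchanged ω r λ x≡c → c∉ (here (sym x≡c))
    ⟦⟧ₜ-shift 𝟎       ω r c∉ = refl
    ⟦⟧ₜ-shift 𝟏       ω r c∉ = refl
    ⟦⟧ₜ-shift (θ ⊕ η) ω r c∉ = cong₂ (RealField._+_ ℛ)
      (⟦⟧ₜ-shift θ ω r (∉-++⁻ˡ (termVars θ) c∉)) (⟦⟧ₜ-shift η ω r (∉-++⁻ʳ (termVars θ) c∉))
    ⟦⟧ₜ-shift (θ ⊗ η) ω r c∉ = cong₂ (RealField._*_ ℛ)
      (⟦⟧ₜ-shift θ ω r (∉-++⁻ˡ (termVars θ) c∉)) (⟦⟧ₜ-shift η ω r (∉-++⁻ʳ (termVars θ) c∉))
    ⟦⟧ₜ-shift (⊖ θ)   ω r c∉ = cong (RealField.-_ ℛ) (⟦⟧ₜ-shift θ ω r c∉)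

    ⟦⟧ₜ-shift* : ∀ {N} (θ : Vec Term N) ω r → c ∉ˡ termsVars θ →
                 map (λ η → ⟦ η ⟧ₜ (ω [ c ↦ r ])) θ ≡ map (λ η → ⟦ η ⟧ₜ ω) θ
    ⟦⟧ₜ-shift* []       ω r c∉ = refl
    ⟦⟧ₜ-shift* (η ∷ ηs) ω r c∉ = cong₂ _∷_
      (⟦⟧ₜ-shift η ω r (∉-++⁻ˡ (termVars η) c∉)) (⟦⟧ₜ-shift* ηs ω r (∉-++⁻ʳ (termVars η) c∉))

    map-shift : ∀ {N} (x : Vec 𝒳 N) ω r → c ∉ˡ toList x → map (ω [ c ↦ r ]) x ≡ map ω x
    map-shift []       ω r c∉ = refl
    map-shift (x ∷ xs) ω r c∉ = cong₂ _∷_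
      (unchanged ω r λ x≡c → c∉ (here (sym x≡c))) (map-shift xs ω r (c∉ ∘ there))

    update*-shift : ∀ {N} (x : Vec 𝒳 N) ω r s → c ∉ˡ toList x →
                    ω [ c ↦ r ] [ x ↦* s ] ≡ ω [ x ↦* s ] [ c ↦ r ]
    update*-shift []       ω r []       c∉ = refl
    update*-shift (x ∷ xs) ω r (s ∷ ss) c∉ =
      trans (cong (_[ x ↦ s ]) (update*-shift xs ω r ss (c∉ ∘ there)))
            (update-comm (ω [ xs ↦* ss ]) r s (c∉ ∘ here))

    ⟦⟧ₐ-shift : ∀ p {ω} r → c ∉ˡ atomVars p → ⟦ p ⟧ₐ ω → ⟦ p ⟧ₐ (ω [ c ↦ r ])
    ⟦⟧ₐ-shift (θ ≐ₜ η) {ω} r c∉ = subst₂ _≡_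
      (sym (⟦⟧ₜ-shift θ ω r (∉-++⁻ˡ (termVars θ) c∉)))
      (sym (⟦⟧ₜ-shift η ω r (∉-++⁻ʳ (termVars θ) c∉)))
    ⟦⟧ₐ-shift (θ <ₜ η) {ω} r c∉ = subst₂ (RealField._<_ ℛ)
      (sym (⟦⟧ₜ-shift θ ω r (∉-++⁻ˡ (termVars θ) c∉)))
      (sym (⟦⟧ₜ-shift η ω r (∉-++⁻ʳ (termVars θ) c∉)))

    -- A change of `c` is undone by changing it back to its old value, so preservation under all
    -- changes already yields the converse.
    unshift : ∀ (P : Pred State 0ℓ) → (∀ {ω} r → P ω → P (ω [ c ↦ r ])) →
              ∀ {ω} r → P (ω [ c ↦ r ]) → P ω
    unshift P shift {ω} r p = subst P (update-restore ω c r) (shift (ω c) p)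

    ⟦⟧ₗ-shift : ∀ p {ω} r → c ∉ˡ literalVars p → ⟦ p ⟧ₗ ω → ⟦ p ⟧ₗ (ω [ c ↦ r ])
    ⟦⟧ₗ-shift (pos p) r c∉      = ⟦⟧ₐ-shift p r c∉
    ⟦⟧ₗ-shift (neg p) r c∉ ¬q q = ¬q (unshift ⟦ p ⟧ₐ (λ s → ⟦⟧ₐ-shift p s c∉) r q)

    ⊨-shift : ∀ φ {ω} r → c ∉ˡ foVars φ → ω ⊨ φ → ω [ c ↦ r ] ⊨ φ
    ⊨-shift (atom p) r c∉        = ⟦⟧ₐ-shift p r c∉
    ⊨-shift (¬ᶠ φ)   r c∉ ¬p p   = ¬p (unshift (_⊨ φ) (λ s → ⊨-shift φ s c∉) r p)
    ⊨-shift (φ ∧ᶠ ψ) r c∉ (p , q) =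
      ⊨-shift φ r (∉-++⁻ˡ (foVars φ) c∉) p , ⊨-shift ψ r (∉-++⁻ʳ (foVars φ) c∉) q
    ⊨-shift (φ ∨ᶠ ψ) r c∉ (inj₁ p) = inj₁ (⊨-shift φ r (∉-++⁻ˡ (foVars φ) c∉) p)
    ⊨-shift (φ ∨ᶠ ψ) r c∉ (inj₂ q) = inj₂ (⊨-shift ψ r (∉-++⁻ʳ (foVars φ) c∉) q)
    ⊨-shift (existsᶠ x φ) {ω} r c∉ (s , p) =
      s , subst (_⊨ φ) (sym (update-comm ω r s (c∉ ∘ here))) (⊨-shift φ r (c∉ ∘ there) p)
    ⊨-shift (forallᶠ x φ) {ω} r c∉ p s =
      subst (_⊨ φ) (sym (update-comm ω r s (c∉ ∘ here))) (⊨-shift φ r (c∉ ∘ there) (p s))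

    -- An action in which `c` does not occur neither reads nor writes it. For an evolution the same
    -- curve is a witness; vector field, endpoints and domain are merely transported.
    ⟦⟧act-shift : ∀ a {ω ω′} r → c ∉ˡ actVars a → ⟦ a ⟧act ω ω′ →
                  ⟦ a ⟧act (ω [ c ↦ r ]) (ω′ [ c ↦ r ])
    ⟦⟧act-shift (x :=*) {ω} r c∉ (s , refl) = s , sym (update-comm ω r s (c∉ ∘ here))
    ⟦⟧act-shift (x := θ) {ω} r c∉ refl =
      trans (sym (update-comm ω r (⟦ θ ⟧ₜ ω) (c∉ ∘ here)))
            (cong (ω [ c ↦ r ] [ x ↦_]) (sym (⟦⟧ₜ-shift θ ω r (c∉ ∘ there))))
    ⟦⟧act-shift (evolve x θ ψ) {ω} {ω′} r c∉ e = record
      { off = off′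
      ; t = t
      ; 0≤t = 0≤t
      ; γ = γ
      ; continuous = continuous
      ; flow = λ s 0<s s<t i →
          subst (λ v → HasDerivativeAt t (λ u → lookup (γ u) i) s (lookup v i))
                (sym (F-shift (γ s))) (flow s 0<s s<t i)
      ; start = trans start (sym (map-shift x ω r c∉x))
      ; end = trans end (sym (map-shift x ω′ r c∉x))
      ; domain = λ s 0≤s s≤t →
          subst (_⊨ ψ) (sym (update*-shift x ω r (γ s) c∉x))
                (⊨-shift ψ r (∉-++⁻ʳ (termsVars θ) c∉θψ) (domain s 0≤s s≤t))
      }
      where
      open Evolution e
      c∉x  = ∉-++⁻ˡ (toList x) c∉
      c∉θψ = ∉-++⁻ʳ (toList x) c∉
      off′ : ∀ y → y ∉ x → (ω′ [ c ↦ r ]) y ≡ (ω [ c ↦ r ]) y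
      off′ y y∉x with em {y ≡ c}
      ... | yes _ = refl
      ... | no _  = off y y∉x
      F-shift : ∀ s → map (λ η → ⟦ η ⟧ₜ (ω [ c ↦ r ] [ x ↦* s ])) θ ≡ F s
      F-shift s =
        trans (cong (λ ω″ → map (λ η → ⟦ η ⟧ₜ ω″) θ) (update*-shift x ω r s c∉x))
              (⟦⟧ₜ-shift* θ (ω [ x ↦* s ]) r (∉-++⁻ˡ (termsVars θ) c∉θψ))

    -- Repetition controlled by the value of `c`

    at : ℕ → State → State
    at n ω = ω [ c ↦ fromℕ n ]

    at-shift : ∀ n ω r → at n (ω [ c ↦ r ]) ≡ at n ω
    at-shift n ω r = update-twice ω c r (fromℕ n)

    slice : ℕ → StateSet → StateSet
    slice n Z ω = Z (at n ω)

    isAt : ℕ → Atom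
    isAt n = var c ≐ₜ numeral n

    jump : ℕ → Game
    jump n = act (c := numeral n)

    ⟦jump⟧⁺ : ∀ n {D : Pred State 0ℓ} {ω} → D (at n ω) → ⟦ jump n ⟧ᵍ D ω
    ⟦jump⟧⁺ n {D} {ω} d = _ , cong (ω [ c ↦_]) (sym (⟦numeral⟧ n ω)) , d

    ⟦jump⟧⁻ : ∀ n {D : Pred State 0ℓ} {ω} → ⟦ jump n ⟧ᵍ D ω → D (at n ω)
    ⟦jump⟧⁻ n {D} {ω} (_ , refl , d) = subst (λ r → D (ω [ c ↦ r ])) (⟦numeral⟧ n ω) d

    -- The two tests take away the choice of when to stop: Angel loses by leaving the loop while `c`
    -- is `n`, and by continuing it at any other value.
    phase : ℕ → Game → Game
    phase n γ = jump n ⨾ loop (test (lit (pos (isAt n))) ⨾ γ) ⨾ test (lit (neg (isAt n)))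

    -- By `body`, the slice at `n` of a pre-fixpoint of the loop is a pre-fixpoint of `f`, and so
    -- contains `lfp f`.
    phase⁺ : ∀ n γ {f D} →
             (∀ Z → (∀ ω → ω c ≢ fromℕ n → D ω → ⌞ Z ⌟ ω) →
                ∀ ω → f (slice n Z) ω → ⟦ γ ⟧ᵍ ⌞ Z ⌟ (at n ω)) →
             ∀ ω r → lfp f ω → ⟦ phase n γ ⟧ᵍ D (ω [ c ↦ r ])
    phase⁺ n γ {f} {D} body ω r p = ⟦jump⟧⁺ n λ Z closed →
      subst ⌞ Z ⌟ (sym (at-shift n ω r)) (p (slice n Z) λ {ω′} q → closed (inj₂
        ( trans (updated ω′ c (fromℕ n)) (sym (⟦numeral⟧ n _))
        , body Z (λ ω″ ≢n d → closed (inj₁ ((λ eq → ≢n (trans eq (⟦numeral⟧ n ω″))) , d))) ω′ q)))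

    -- Conversely, a pre-fixpoint `Z₀` of `f` is spread out to a pre-fixpoint `Z` of the loop whose
    -- slice at `n` lies inside `Z₀` and which elsewhere lies inside the goal.
    phase⁻ : ∀ n γ {f D} →
             (∀ Z Z₀ → (∀ ω → ⌞ Z ⌟ (at n ω) → ⌞ Z₀ ⌟ ω) →
                (∀ ω → ω c ≢ fromℕ n → ⌞ Z ⌟ ω → D ω) →
                ∀ ω r → ⟦ γ ⟧ᵍ ⌞ Z ⌟ (ω [ c ↦ r ]) → f Z₀ ω) →
             ∀ ω r → ⟦ phase n γ ⟧ᵍ D (ω [ c ↦ r ]) → lfp f ω
    phase⁻ n γ {f} {D} body ω r p Z₀ closed =
      Z-slice ω (subst ⌞ Z ⌟ (at-shift n ω r) (⟦jump⟧⁻ n p Z Z-closed))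
      where
      -- `Z₀` may depend on `c`, whereas in the slice `n` the former value of `c` is lost. So all
      -- variants of the state in `c` are required to lie in `Z₀`.
      P : Pred State 0ℓ
      P ω = (ω c ≡ fromℕ n → ∀ s → ⌞ Z₀ ⌟ (ω [ c ↦ s ])) × (ω c ≢ fromℕ n → D ω)

      Z : StateSet
      Z = setOf P

      Z-slice : ∀ ω → ⌞ Z ⌟ (at n ω) → ⌞ Z₀ ⌟ ω
      Z-slice ω z = subst ⌞ Z₀ ⌟ (update-restore ω c (fromℕ n))
        (proj₁ (toWitness z) (updated ω c (fromℕ n)) (ω c))

      Z-rest : ∀ ω → ω c ≢ fromℕ n → ⌞ Z ⌟ ω → D ω
      Z-rest ω ≢n z = proj₂ (toWitness z) ≢n

      Z-closed : ∀ {ω} → (ω c ≢ ⟦ numeral n ⟧ₜ ω × D ω) ⊎ (ω c ≡ ⟦ numeral n ⟧ₜ ω × ⟦ γ ⟧ᵍ ⌞ Z ⌟ ω) →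
                 ⌞ Z ⌟ ω
      Z-closed {ω} (inj₁ (≢n , d)) = fromWitness
        ((λ eq → contradiction (trans eq (sym (⟦numeral⟧ n ω))) ≢n) , λ _ → d)
      Z-closed {ω} (inj₂ (≡n , q)) = fromWitness
        -- `body` applies to every variant `ω [ c ↦ s ]`, since resetting `c` to `ω c` leads back to
        -- the state `ω` where `γ` is won.
        ( (λ _ s → closed (body Z Z₀ Z-slice Z-rest (ω [ c ↦ s ]) (ω c)
                     (subst (⟦ γ ⟧ᵍ ⌞ Z ⌟) (sym (update-restore ω c s)) q)))
        , λ ≢n → contradiction (trans ≡n (⟦numeral⟧ n ω)) ≢n)

    -- Every play of this game ends at once in favour of Angel.
    victory : Game
    victory = dual (test (lit (neg (𝟎 ≐ₜ 𝟎))))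

    -- The evaluation game of a formula

    _[_≔_] : (PVar → ℕ) → PVar → ℕ → PVar → ℕ
    (ρ [ X ≔ n ]) Y = if ⌊ em {Y ≡ X} ⌋ then n else ρ Y

    -- `ρ` numbers the variables in scope and `n` exceeds all numbers in use; disjoint subformulas
    -- may reuse numbers. A literal decides the play at once through `victory`, regardless of the
    -- goal.
    game : μFormula → (PVar → ℕ) → ℕ → Game
    game (lit p)   ρ n = test (lit p) ⨾ victory
    game (var X)   ρ n = jump (ρ X)
    game (φ ∨ ψ)   ρ n = game φ ρ n ∪ game ψ ρ n
    game (φ ∧ ψ)   ρ n = dual (dual (game φ ρ n) ∪ dual (game ψ ρ n))
    game (⟨ a ⟩ φ) ρ n = act a ⨾ game φ ρ n
    game ([ a ] φ) ρ n = dual (act a) ⨾ game φ ρ n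
    game (μ X ψ _) ρ n = phase n (game ψ (ρ [ X ≔ n ]) (suc n))
    -- The outer `dual` hands the loop to Demon, the inner one restores the roles within the body.
    game (ν X ψ _) ρ n = dual (phase n (dual (game ψ (ρ [ X ≔ n ]) (suc n))))

    -- Correctness of the evaluation game

    Numbered : μFormula → (PVar → ℕ) → ℕ → Set
    Numbered φ ρ n = ∀ {Y} → Free Y φ → ρ Y ℕ.< n

    binder-numbered : ∀ {X ψ ρ n} → (∀ {Y} → Y ≢ X × Free Y ψ → ρ Y ℕ.< n) →
                      Numbered ψ (ρ [ X ≔ n ]) (suc n)
    binder-numbered {X} ρ< {Y} free with em {Y ≡ X}
    ... | yes _  = ℕ.n<1+n _
    ... | no Y≢X = ℕ.m<n⇒m<1+n (ρ< (Y≢X , free))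

    -- The goal of the game encodes a valuation, the value of `Y` being its slice at `ρ Y`. The two
    -- inclusions are kept apart, one for each direction of correctness.
    _⟶[_,_]_ : Valuation → μFormula → (PVar → ℕ) → Pred State 0ℓ → Set
    V ⟶[ φ , ρ ] D = ∀ {Y} → Free Y φ → ∀ ω → ⌞ value V Y ⌟ ω → D (at (ρ Y) ω)

    _⟵[_,_]_ : Valuation → μFormula → (PVar → ℕ) → Pred State 0ℓ → Set
    V ⟵[ φ , ρ ] D = ∀ {Y} → Free Y φ → ∀ ω → D (at (ρ Y) ω) → ⌞ value V Y ⌟ ω

    at-away : ∀ {m n} ω → m ℕ.< n → at m ω c ≢ fromℕ n
    at-away ω m<n eq = fromℕ-distinct m<n (trans (sym (updated ω c _)) eq)

    module Binder {X : PVar} {ψ : μFormula} {ρ : PVar → ℕ} {n : ℕ} {V : Valuation}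
                  {D : Pred State 0ℓ} (¬m : ¬ Mentions (complement X) ψ)
                  (ρ< : ∀ {Y} → Y ≢ X × Free Y ψ → ρ Y ℕ.< n)
                  {Z : StateSet} {E : Pred State 0ℓ} where

      -- The variables already in scope have numbers below `n`, so their slices lie where `outside`
      -- relates the old goal `D` to the new goal `E`. The slice at `n` is left to `inside`.
      binder⟶ : (∀ {Y} → Y ≢ X × Free Y ψ → ∀ ω → ⌞ value V Y ⌟ ω → D (at (ρ Y) ω)) →
                (∀ ω → ⌞ Z ⌟ ω → E (at n ω)) → (∀ ω → ω c ≢ fromℕ n → D ω → E ω) →
                (V ⟨ X ↦ Z ⟩) ⟶[ ψ , ρ [ X ≔ n ] ] E
      binder⟶ env inside outside {Y} free ω v with em {Y ≡ X}
      ... | yes refl = inside ω (subst (λ S → ⌞ S ⌟ ω) (value-updated V X Z) v)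
      ... | no Y≢X   = outside _ (at-away ω (ρ< (Y≢X , free))) (env (Y≢X , free) ω
        (subst (λ S → ⌞ S ⌟ ω) (value-unchanged V Z Y≢X (Free⇒≢complement {X} ψ ¬m free)) v))

      binder⟵ : (∀ {Y} → Y ≢ X × Free Y ψ → ∀ ω → D (at (ρ Y) ω) → ⌞ value V Y ⌟ ω) →
                (∀ ω → E (at n ω) → ⌞ Z ⌟ ω) → (∀ ω → ω c ≢ fromℕ n → E ω → D ω) →
                (V ⟨ X ↦ Z ⟩) ⟵[ ψ , ρ [ X ≔ n ] ] E
      binder⟵ env inside outside {Y} free ω v with em {Y ≡ X}
      ... | yes refl = subst (λ S → ⌞ S ⌟ ω) (sym (value-updated V X Z)) (inside ω v)
      ... | no Y≢X   =
        subst (λ S → ⌞ S ⌟ ω) (sym (value-unchanged V Z Y≢X (Free⇒≢complement {X} ψ ¬m free)))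
              (env (Y≢X , free) ω (outside _ (at-away ω (ρ< (Y≢X , free))) v))

    open Binder

    -- This brings `ν` into the least-fixpoint form treated by `phase⁺` and `phase⁻`; the dual of
    -- the game for `ψ` plays the negated body.
    gfp-dual : ∀ X ψ V → gfp (λ Z → ⟦ ψ ⟧μ (V ⟨ X ↦ Z ⟩)) ≐
                         ∁ (lfp λ Z → ∁ (⟦ ψ ⟧μ (V ⟨ X ↦ not ∘ Z ⟩)))
    gfp-dual X ψ V = gfp≐∁lfp λ Z →
      (λ {ω} q ¬q → ¬q (subst (λ S → ⟦ ψ ⟧μ (V ⟨ X ↦ S ⟩) ω) (sym (not-not Z)) q)) ,
      (λ {ω} q → subst (λ S → ⟦ ψ ⟧μ (V ⟨ X ↦ S ⟩) ω) (not-not Z) (stable q))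

    -- That env is merely an inclusion lets the induction itself supply the
    -- monotonicity needed at the fixpoints: there D becomes an arbitrary
    -- pre-fixpoint Z of the loop.
    game⁺ : ∀ φ {ρ n V D} → c ∉ˡ vars φ → Numbered φ ρ n → V ⟶[ φ , ρ ] D →
            ∀ ω r → ⟦ φ ⟧μ V ω → ⟦ game φ ρ n ⟧ᵍ D (ω [ c ↦ r ])
    game⁺ (lit p) c∉ ρ< env ω r q = ⟦⟧ₗ-shift p r c∉ q , λ { (0≢0 , _) → 0≢0 refl }
    game⁺ (var X) {ρ} {D = D} c∉ ρ< env ω r q =
      ⟦jump⟧⁺ (ρ X) {D} (subst D (sym (at-shift (ρ X) ω r)) (env refl ω q))
    game⁺ (φ ∨ ψ) c∉ ρ< env ω r (inj₁ q) =
      inj₁ (game⁺ φ (∉-++⁻ˡ (vars φ) c∉) (ρ< ∘ inj₁) (env ∘ inj₁) ω r q)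
    game⁺ (φ ∨ ψ) c∉ ρ< env ω r (inj₂ q) =
      inj₂ (game⁺ ψ (∉-++⁻ʳ (vars φ) c∉) (ρ< ∘ inj₂) (env ∘ inj₂) ω r q)
    game⁺ (φ ∧ ψ) c∉ ρ< env ω r (p , q) = λ where
      (inj₁ ¬p) → ¬p (game⁺ φ (∉-++⁻ˡ (vars φ) c∉) (ρ< ∘ inj₁)
                        (λ free ω v ¬d → ¬d (env (inj₁ free) ω v)) ω r p)
      (inj₂ ¬q) → ¬q (game⁺ ψ (∉-++⁻ʳ (vars φ) c∉) (ρ< ∘ inj₂)
                        (λ free ω v ¬d → ¬d (env (inj₂ free) ω v)) ω r q)
    game⁺ (⟨ a ⟩ φ) c∉ ρ< env ω r (ω′ , s , q) =
      ω′ [ c ↦ r ] , ⟦⟧act-shift a r (∉-++⁻ˡ (actVars a) c∉) s ,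
      game⁺ φ (∉-++⁻ʳ (actVars a) c∉) ρ< env ω′ r q
    game⁺ ([ a ] φ) {ρ} {n} {D = D} c∉ ρ< env ω r q (ω″ , s , ¬p) =
      -- The play moves from `ω` with `c` overwritten. Resetting `c` to `ω c` at both ends makes
      -- this a transition from `ω` itself, to which `q` applies.
      ¬p (subst (⟦ game φ ρ n ⟧ᵍ D) (update-restore ω″ c (ω c))
        (game⁺ φ (∉-++⁻ʳ (actVars a) c∉) ρ< env (ω″ [ c ↦ ω c ]) (ω″ c) (q _
          (subst (λ ω′ → ⟦ a ⟧act ω′ (ω″ [ c ↦ ω c ])) (update-restore ω c r)
            (⟦⟧act-shift a (ω c) (∉-++⁻ˡ (actVars a) c∉) s)))))
    game⁺ (μ X ψ ¬m) {ρ} {n} c∉ ρ< env = phase⁺ n γ λ Z D⊆Z ω →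
      game⁺ ψ {D = ⌞ Z ⌟} c∉ (binder-numbered {ψ = ψ} ρ<)
        (binder⟶ {ψ = ψ} ¬m ρ< env (λ _ → id) D⊆Z) ω (fromℕ n)
      where γ = game ψ (ρ [ X ≔ n ]) (suc n)
    -- Complementing exchanges the directions: a win `p` of the dual phase for `∁ D` would, by
    -- `phase⁻`, put `ω` into the complementary least fixpoint. The induction hypothesis is
    -- therefore used with goal `∁ ⌞ Z ⌟`.
    game⁺ (ν X ψ ¬m) {ρ} {n} {V} c∉ ρ< env ω r q p = proj₁ (gfp-dual X ψ V) q
      (phase⁻ n (dual γ) (λ Z Z₀ Z⊆Z₀ Z⊆∁D ω r ¬q q → ¬q
        (game⁺ ψ {D = ∁ ⌞ Z ⌟} c∉ (binder-numbered {ψ = ψ} ρ<)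
          (binder⟶ {ψ = ψ} ¬m ρ< env (λ ω ¬z z → T-not⁻ (Z₀ ω) ¬z (Z⊆Z₀ ω z))
            (λ ω ≢n d z → Z⊆∁D ω ≢n z d)) ω r q)) ω r p)
      where γ = game ψ (ρ [ X ≔ n ]) (suc n)

    game⁻ : ∀ φ {ρ n V D} → c ∉ˡ vars φ → Numbered φ ρ n → V ⟵[ φ , ρ ] D →
            ∀ ω r → ⟦ game φ ρ n ⟧ᵍ D (ω [ c ↦ r ]) → ⟦ φ ⟧μ V ω
    game⁻ (lit p) c∉ ρ< env ω r (q , _) = unshift ⟦ p ⟧ₗ (λ s → ⟦⟧ₗ-shift p s c∉) r q
    game⁻ (var X) {ρ} {D = D} c∉ ρ< env ω r q =
      env refl ω (subst D (at-shift (ρ X) ω r) (⟦jump⟧⁻ (ρ X) {D} q))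
    game⁻ (φ ∨ ψ) c∉ ρ< env ω r (inj₁ q) =
      inj₁ (game⁻ φ (∉-++⁻ˡ (vars φ) c∉) (ρ< ∘ inj₁) (env ∘ inj₁) ω r q)
    game⁻ (φ ∨ ψ) c∉ ρ< env ω r (inj₂ q) =
      inj₂ (game⁻ ψ (∉-++⁻ʳ (vars φ) c∉) (ρ< ∘ inj₂) (env ∘ inj₂) ω r q)
    game⁻ (φ ∧ ψ) c∉ ρ< env ω r q =
      game⁻ φ (∉-++⁻ˡ (vars φ) c∉) (ρ< ∘ inj₁)
        (λ free ω ¬¬d → env (inj₁ free) ω (stable ¬¬d)) ω r (stable (q ∘ inj₁)) ,
      game⁻ ψ (∉-++⁻ʳ (vars φ) c∉) (ρ< ∘ inj₂)
        (λ free ω ¬¬d → env (inj₂ free) ω (stable ¬¬d)) ω r (stable (q ∘ inj₂))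
    game⁻ (⟨ a ⟩ φ) {ρ} {n} {D = D} c∉ ρ< env ω r (ω″ , s , q) =
      ω″ [ c ↦ ω c ] ,
      subst (λ ω′ → ⟦ a ⟧act ω′ (ω″ [ c ↦ ω c ])) (update-restore ω c r)
        (⟦⟧act-shift a (ω c) (∉-++⁻ˡ (actVars a) c∉) s) ,
      game⁻ φ (∉-++⁻ʳ (actVars a) c∉) ρ< env (ω″ [ c ↦ ω c ]) (ω″ c)
        (subst (⟦ game φ ρ n ⟧ᵍ D) (sym (update-restore ω″ c (ω c))) q)
    game⁻ ([ a ] φ) c∉ ρ< env ω r q ω′ s =
      game⁻ φ (∉-++⁻ʳ (actVars a) c∉) ρ< env ω′ r
        (stable λ ¬p → q (ω′ [ c ↦ r ] , ⟦⟧act-shift a r (∉-++⁻ˡ (actVars a) c∉) s , ¬p))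
    game⁻ (μ X ψ ¬m) {ρ} {n} c∉ ρ< env = phase⁻ n γ λ Z Z₀ Z⊆Z₀ Z⊆D →
      game⁻ ψ {D = ⌞ Z ⌟} c∉ (binder-numbered {ψ = ψ} ρ<) (binder⟵ {ψ = ψ} ¬m ρ< env Z⊆Z₀ Z⊆D)
      where γ = game ψ (ρ [ X ≔ n ]) (suc n)
    -- For the same reason `phase⁺` appears here: membership in the complementary least fixpoint
    -- would let the dual phase be won for `∁ D`, against `p`.
    game⁻ (ν X ψ ¬m) {ρ} {n} {V} c∉ ρ< env ω r p = proj₂ (gfp-dual X ψ V) λ q → p
      (phase⁺ n (dual γ) (λ Z ∁D⊆Z ω ¬q q → ¬q
        (game⁻ ψ {D = ∁ ⌞ Z ⌟} c∉ (binder-numbered {ψ = ψ} ρ<)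
          (binder⟵ {ψ = ψ} ¬m ρ< env (λ ω → T-not⁺ (Z (at n ω)))
            (λ ω ≢n ¬z → stable (¬z ∘ ∁D⊆Z ω ≢n))) ω (fromℕ n) q)) ω r q)
      where γ = game ψ (ρ [ X ≔ n ]) (suc n)

  dLμ⇒dGL : Infinite 𝒳 → ∀ (ψ : dLμ) → ∃ λ φ → SameStates φ ψ
  dLμ⇒dGL 𝒳-infinite (ψ , closed) with c , c∉ψ ← 𝒳-infinite (vars ψ) =
    -- As `ψ` is closed, every goal encodes every valuation vacuously and any numbering is
    -- admissible; a tautology and zero are picked. Overwriting `c` with `ω c` lets the game start
    -- in `ω` itself.
    (⟨ γ ⟩ lit (pos (𝟎 ≐ₜ 𝟎))) , λ V →
      (λ {ω} p → game⁻ ψ c∉ψ (⊥-elim ∘ closed _) (⊥-elim ∘ closed _) ω (ω c)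
                   (subst (⟦ γ ⟧ᵍ _) (sym (update-id ω c)) p)) ,
      (λ {ω} p → subst (⟦ γ ⟧ᵍ _) (update-id ω c)
                   (game⁺ ψ {V = V} c∉ψ (⊥-elim ∘ closed _) (⊥-elim ∘ closed _) ω (ω c) p))
    where
    open ToGames c
    γ : Game
    γ = game ψ (λ _ → 0) 0

corollary6p1 : (em : ExcludedMiddle 0ℓ) → Extensionality 0ℓ 0ℓ →
    (𝒳 𝒱 : Set) → Infinite 𝒳 → Infinite 𝒱 → (ℛ : RealField) →
    let open Semantics em 𝒳 𝒱 ℛ in
    (∀ (φ : dGL) → ∃ λ (ψ : dLμ) → SameStates φ ψ) ×
    (∀ (ψ : dLμ) → ∃ λ (φ : dGL) → SameStates φ ψ)
corollary6p1 em ext 𝒳 𝒱 𝒳-infinite 𝒱-infinite ℛ =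
  FromGames.dGL⇒dLμ 𝒱-infinite , dLμ⇒dGL 𝒳-infinite
  where open Equiexpressiveness em ext 𝒳 𝒱 ℛ
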